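{- For every fixed integer $\ell \ge 3$, \[ r(s;\ell) = \Omega\left(2^{(\ell-1)s/2}\right) \] as $s \to \infty$.
   Context: For positive integers $s$ and $\ell$, the multicolor Ramsey number $r(s;\ell)$ is the minimum integer $n$ such that every coloring of the edges of the complete graph $K_n$ with $\ell$ colors contains a monochromatic clique of size $s$. -}

module Defs where

open import Data.Fin.Base using (Fin; zero; suc)
open import Data.Fin.Properties using (_≟_; all?; any?)
open import Data.Fin.Subset using (Subset; _∈_; _∉_; ⁅_⁆; _∪_; ∣_∣; inside; outside) renaming (⊥ to ∅)
open import Data.Fin.Subset.Properties using (_∈?_; anySubset?; x∈⁅y⁆⇒x≡y; x∈p∪q⁻; ∉⊥; ∣⊥∣≡0; ∪-identityˡ)
import Data.Integer.Base as ℤ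
open import Data.List.Base using (List; []; _∷_; length; filter; map; take; allFin)
import Data.List.Membership.Propositional as L
open import Data.List.Membership.Propositional.Properties using (∈-allFin)
open import Data.List.Properties using (length-take; length-map; length-tabulate)
open import Data.List.Relation.Unary.All as All using (All; []; _∷_)
import Data.List.Relation.Unary.All.Properties as All
open import Data.List.Relation.Unary.AllPairs using (AllPairs; []; _∷_)
import Data.List.Relation.Unary.AllPairs.Properties as AllPairs
open import Data.List.Relation.Unary.Any using (here; there)
open import Data.List.Relation.Unary.Unique.Propositional using (Unique)
open import Data.List.Relation.Unary.Unique.Propositional.Properties using (allFin⁺)
open import Data.Nat.Base as ℕ using (ℕ; zero; suc; z≤n; s≤s)
import Data.Nat.Properties as ℕ
open import Data.Product.Base using (∃; ∃-syntax; _×_; _,_; proj₁; proj₂)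
open import Data.Rational.Unnormalised.Base using (ℚᵘ; 0ℚᵘ; _/_; _≤_; _<_; _*_)
open import Data.Sum.Base using (inj₁; inj₂)
open import Data.Vec.Base using (Vec; []; _∷_; lookup; tabulate; here; there)
open import Data.Vec.Properties using (lookup∘tabulate)
open import Function.Base using (_∘_; id)
open import Relation.Binary.PropositionalEquality using (_≡_; _≢_; refl; sym; trans; cong; subst)
open import Relation.Nullary using (Dec; yes; no; ¬?; contradiction)
open import Relation.Nullary.Decidable using (map′; _→-dec_; _×-dec_)
open import Relation.Unary using (Decidable)

-- An edge {i , j} of Kₙ is represented by both (i , j) and (j , i); the values
-- on the diagonal carry no meaning and are never inspected below (for ℓ ≥ 1 they
-- can be chosen freely, so they do not affect which colourings exist).
record EdgeColouring (n ℓ : ℕ) : Set where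
  field
    colour    : Fin n → Fin n → Fin ℓ
    symmetric : ∀ i j → colour i j ≡ colour j i

open EdgeColouring public

IsMonochromatic : ∀ {n ℓ} → (Fin n → Fin n → Fin ℓ) → Fin ℓ → Subset n → Set
IsMonochromatic χ k S = ∀ i j → i ∈ S → j ∈ S → i ≢ j → χ i j ≡ k

HasMonochromaticClique : ∀ {n ℓ} → (Fin n → Fin n → Fin ℓ) → ℕ → Set
HasMonochromaticClique {n} {ℓ} χ s =
  ∃[ S ] ∣ S ∣ ≡ s × (∃[ k ] IsMonochromatic χ k S)

Arrows : (s ℓ n : ℕ) → Set
Arrows s ℓ n = (χ : EdgeColouring n ℓ) → HasMonochromaticClique (colour χ) s

IsRamseyNumber : (s ℓ n : ℕ) → Set
IsRamseyNumber s ℓ n = Arrows s ℓ n × (∀ m → Arrows s ℓ m → n ℕ.≤ m)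

-- The rest of the development up to `r` shows that a Ramsey number exists:
-- Arrows s ℓ is decidable, and it holds for some n by Ramsey's theorem.

private
  hasMonochromaticClique? : ∀ {n ℓ} (χ : Fin n → Fin n → Fin ℓ) s →
                            Dec (HasMonochromaticClique χ s)
  hasMonochromaticClique? χ s = anySubset? λ S →
    (∣ S ∣ ℕ.≟ s) ×-dec any? λ k → all? λ i → all? λ j →
      (i ∈? S) →-dec ((j ∈? S) →-dec (¬? (i ≟ j) →-dec (χ i j ≟ k)))

  Exhaustible : Set → Set₁
  Exhaustible A = {P : A → Set} → Decidable P → Dec (∀ x → P x)

  allVec? : ∀ {A} → Exhaustible A → ∀ n → Exhaustible (Vec A n)
  allVec? A? zero    P? = map′ (λ { p [] → p }) (λ f → f []) (P? [])
  allVec? A? (suc n) P? =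
    map′ (λ { f (x ∷ xs) → f x xs }) (λ f x xs → f (x ∷ xs))
         (A? λ x → allVec? A? n λ xs → P? (x ∷ xs))

  entry : ∀ {n ℓ} → Vec (Vec (Fin ℓ) n) n → Fin n → Fin n → Fin ℓ
  entry M i j = lookup (lookup M i) j

  table : ∀ {n ℓ} → (Fin n → Fin n → Fin ℓ) → Vec (Vec (Fin ℓ) n) n
  table χ = tabulate λ i → tabulate (χ i)

  entry-table : ∀ {n ℓ} (χ : Fin n → Fin n → Fin ℓ) i j → entry (table χ) i j ≡ χ i j
  entry-table χ i j =
    trans (cong (λ v → lookup v j) (lookup∘tabulate (λ i → tabulate (χ i)) i))
          (lookup∘tabulate (χ i) j)

  arrows? : ∀ s ℓ → Decidable (Arrows s ℓ)
  arrows? s ℓ n = map′ to from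
    (allVec? (allVec? all? n) n λ M →
      (all? λ i → all? λ j → entry M i j ≟ entry M j i)
        →-dec hasMonochromaticClique? (entry M) s)
    where
    to : (∀ M → (∀ i j → entry M i j ≡ entry M j i) → HasMonochromaticClique (entry M) s) →
         Arrows s ℓ n
    to h χ with h (table (colour χ)) (λ i j →
                  trans (entry-table (colour χ) i j)
                    (trans (symmetric χ i j) (sym (entry-table (colour χ) j i))))
    ... | S , ∣S∣ , k , mono = S , ∣S∣ , k , λ i j i∈ j∈ i≢j →
          trans (sym (entry-table (colour χ) i j)) (mono i j i∈ j∈ i≢j)
    from : Arrows s ℓ n →
           ∀ M → (∀ i j → entry M i j ≡ entry M j i) → HasMonochromaticClique (entry M) s
    from h M M-sym = h record { colour = entry M ; symmetric = M-sym }

  least : ∀ {P : ℕ → Set} → Decidable P → ∀ N → P N → ∃[ n ] P n × (∀ m → P m → n ℕ.≤ m)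
  least P? zero    p = 0 , p , λ _ _ → z≤n
  least P? (suc N) p with P? 0
  ... | yes p₀ = 0 , p₀ , λ _ _ → z≤n
  ... | no ¬p₀ with least (P? ∘ suc) N p
  ...   | n , pn , n-min = suc n , pn , λ
          { zero    p₀ → contradiction p₀ ¬p₀
          ; (suc m) pm → s≤s (n-min m pm) }

  length-filter-split : ∀ {A : Set} {Q : A → Set} (Q? : Decidable Q) (xs : List A) →
    length (filter Q? xs) ℕ.+ length (filter (¬? ∘ Q?) xs) ≡ length xs
  length-filter-split Q? [] = refl
  length-filter-split Q? (x ∷ xs) with Q? x
  ... | yes _ = cong suc (length-filter-split Q? xs)
  ... | no  _ = trans (ℕ.+-suc _ _) (cong suc (length-filter-split Q? xs))

  pigeonhole : ∀ {A : Set} {ℓ} {R : A → A → Set} {Q : A → Set}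
               (f : A → Fin ℓ) m ks xs →
               AllPairs R xs → All Q xs → All (λ x → f x L.∈ ks) xs →
               length ks ℕ.* m ℕ.< length xs →
               ∃[ k ] ∃[ ys ] AllPairs R ys × All Q ys × All (λ y → f y ≡ k) ys × m ℕ.< length ys
  pigeonhole f m [] (x ∷ xs) _ _ (() ∷ _) _
  pigeonhole f m (k ∷ ks) xs rs qs fs lt
    with m ℕ.<? length (filter (λ x → f x ≟ k) xs)
  ... | yes m< = k , filter k? xs , AllPairs.filter⁺ k? rs , All.filter⁺ k? qs ,
                 All.all-filter k? xs , m<
    where k? = λ x → f x ≟ k
  ... | no m≮ = pigeonhole f m ks (filter ¬k? xs) (AllPairs.filter⁺ ¬k? rs)
                  (All.filter⁺ ¬k? qs)
                  (All.zipWith (λ { (here e , ≢k) → contradiction e ≢k ; (there e , _) → e })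
                    (All.filter⁺ ¬k? fs , All.all-filter ¬k? xs))
                  (ℕ.+-cancelˡ-< m _ _ (ℕ.<-≤-trans lt (ℕ.≤-trans
                    (ℕ.≤-reflexive (sym (length-filter-split k? xs)))
                    (ℕ.+-monoˡ-≤ _ (ℕ.≮⇒≥ m≮)))))
    where
    k?  = λ x → f x ≟ k
    ¬k? = ¬? ∘ k?

  pigeonhole-Fin : ∀ {A : Set} {ℓ} {R : A → A → Set} {Q : A → Set}
               (f : A → Fin ℓ) m xs → AllPairs R xs → All Q xs →
               ℓ ℕ.* m ℕ.< length xs →
               ∃[ k ] ∃[ ys ] AllPairs R ys × All Q ys × All (λ y → f y ≡ k) ys × m ℕ.< length ys
  pigeonhole-Fin {ℓ = ℓ} f m xs rs qs lt =
    pigeonhole f m (allFin ℓ) xs rs qs (All.universal (∈-allFin ∘ f) xs)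
      (subst (λ l → l ℕ.* m ℕ.< length xs) (sym (length-tabulate {n = ℓ} id)) lt)

  list→subset : ∀ {n} → List (Fin n) → Subset n
  list→subset []       = ∅
  list→subset (x ∷ xs) = ⁅ x ⁆ ∪ list→subset xs

  ∈-list : ∀ {n} (xs : List (Fin n)) {i} → i ∈ list→subset xs → i L.∈ xs
  ∈-list []       i∈ = contradiction i∈ ∉⊥
  ∈-list (x ∷ xs) i∈ with x∈p∪q⁻ ⁅ x ⁆ (list→subset xs) i∈
  ... | inj₁ i∈x  = here (x∈⁅y⁆⇒x≡y x i∈x)
  ... | inj₂ i∈xs = there (∈-list xs i∈xs)

  ∣⁅x⁆∪p∣ : ∀ {n} (x : Fin n) p → x ∉ p → ∣ ⁅ x ⁆ ∪ p ∣ ≡ suc ∣ p ∣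
  ∣⁅x⁆∪p∣ zero    (outside ∷ p) _  = cong (suc ∘ ∣_∣) (∪-identityˡ p)
  ∣⁅x⁆∪p∣ zero    (inside ∷ p)  x∉ = contradiction here x∉
  ∣⁅x⁆∪p∣ (suc x) (outside ∷ p) x∉ = ∣⁅x⁆∪p∣ x p (x∉ ∘ there)
  ∣⁅x⁆∪p∣ (suc x) (inside ∷ p)  x∉ = cong suc (∣⁅x⁆∪p∣ x p (x∉ ∘ there))

  ∣list∣ : ∀ {n} (xs : List (Fin n)) → Unique xs → ∣ list→subset xs ∣ ≡ length xs
  ∣list∣ {n} []   []       = ∣⊥∣≡0 n
  ∣list∣ (x ∷ xs) (x∉ ∷ u) =
    trans (∣⁅x⁆∪p∣ x (list→subset xs) (λ x∈ → All.lookup x∉ (∈-list xs x∈) refl))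
          (cong suc (∣list∣ xs u))

  preSize : ℕ → ℕ → ℕ
  preSize ℓ zero    = 0
  preSize ℓ (suc m) = 2 ℕ.+ ℓ ℕ.* preSize ℓ m

  module _ {n ℓ} (χ : EdgeColouring n ℓ) where

    c = colour χ

    Joined : Fin n × Fin ℓ → Fin n × Fin ℓ → Set
    Joined (x , k) (y , _) = x ≢ y × c x y ≡ k

    JoinedBy : Fin ℓ → Fin n → Fin n → Set
    JoinedBy k x y = x ≢ y × c x y ≡ k

    -- Each vertex of the list found is joined to all later ones in the colour
    -- it is paired with.
    prehomogeneous : ∀ {Q : Fin n → Set} m xs → Unique xs → All Q xs →
      preSize ℓ m ℕ.≤ length xs →
      ∃[ ps ] AllPairs Joined ps × All (Q ∘ proj₁) ps × length ps ≡ m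
    prehomogeneous zero    _        _        _        _        = [] , [] , [] , refl
    prehomogeneous (suc m) (x ∷ xs) (x∉ ∷ u) (q ∷ qs) (s≤s le)
      with pigeonhole-Fin (c x) (preSize ℓ m) xs u (All.zip (x∉ , qs)) le
    ... | k , ys , uys , qys , cys , lt
      with prehomogeneous m ys uys (All.zip (qys , cys)) (ℕ.<⇒≤ lt)
    ... | ps , js , qps , len =
          (x , k) ∷ ps
        , All.map (λ { ((x≢y , _) , e) → x≢y , e }) qps ∷ js
        , q ∷ All.map (λ { ((_ , qy) , _) → qy }) qps
        , cong suc len

    homogeneous : ∀ {k} ps → AllPairs Joined ps → All (λ p → proj₂ p ≡ k) ps →
                  AllPairs (JoinedBy k) (map proj₁ ps)
    homogeneous []             []       []          = []
    homogeneous ((x , k) ∷ ps) (j ∷ js) (refl ∷ es) = All.map⁺ j ∷ homogeneous ps js es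

    joinedBy-lookup : ∀ {k} xs → AllPairs (JoinedBy k) xs →
                      ∀ {i j} → i L.∈ xs → j L.∈ xs → i ≢ j → c i j ≡ k
    joinedBy-lookup (x ∷ xs) (j ∷ js) (here refl) (here refl) i≢j = contradiction refl i≢j
    joinedBy-lookup (x ∷ xs) (j ∷ js) (here refl) (there b)   _   = proj₂ (All.lookup j b)
    joinedBy-lookup (x ∷ xs) (j ∷ js) (there a)   (here refl) _   =
      trans (symmetric χ _ _) (proj₂ (All.lookup j a))
    joinedBy-lookup (x ∷ xs) (j ∷ js) (there a)   (there b)   i≢j = joinedBy-lookup xs js a b i≢j

    unique : ∀ {k xs} → AllPairs (JoinedBy k) xs → Unique xs
    unique []       = []
    unique (j ∷ js) = All.map proj₁ j ∷ unique js

    monochromaticClique : ∀ s → preSize ℓ (suc (ℓ ℕ.* s)) ℕ.≤ n → HasMonochromaticClique c s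
    monochromaticClique s le
      with prehomogeneous (suc (ℓ ℕ.* s)) (allFin n) (allFin⁺ n) (All.universal {P = λ i → i ≡ i} (λ _ → refl) (allFin n))
             (subst (preSize ℓ (suc (ℓ ℕ.* s)) ℕ.≤_) (sym (length-tabulate {n = n} id)) le)
    ... | ps , js , qs , len
      with pigeonhole-Fin proj₂ s ps js qs (ℕ.≤-reflexive (sym len))
    ... | k , ys , jys , _ , kys , lt =
          list→subset zs
        , trans (∣list∣ zs (unique hom))
            (trans (length-take s (map proj₁ ys))
              (ℕ.m≤n⇒m⊓n≡m (ℕ.≤-trans (ℕ.<⇒≤ lt) (ℕ.≤-reflexive (sym (length-map proj₁ ys))))))
        , k
        , λ i j i∈ j∈ → joinedBy-lookup zs hom (∈-list zs i∈) (∈-list zs j∈)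
      where
      zs = take s (map proj₁ ys)
      hom = AllPairs.take⁺ s (homogeneous ys jys kys)

ramseyNumber : ∀ s ℓ → ∃ (IsRamseyNumber s ℓ)
ramseyNumber s ℓ = least (arrows? s ℓ) (preSize ℓ (suc (ℓ ℕ.* s)))
  λ χ → monochromaticClique χ s ℕ.≤-refl

r : (s ℓ : ℕ) → ℕ
r s ℓ = proj₁ (ramseyNumber s ℓ)

r-isRamseyNumber : ∀ s ℓ → IsRamseyNumber s ℓ (r s ℓ)
r-isRamseyNumber s ℓ = proj₂ (ramseyNumber s ℓ)

fromℕ : ℕ → ℚᵘ
fromℕ n = ℤ.+ n / 1

-- f = Ω(√g) as s → ∞.  Both sides of  f s ≥ c √(g s)  are nonnegative, so the
-- inequality is stated after squaring; every positive real exceeds a positive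
-- rational, so it is no restriction to take the constant c rational.
_=Ω√_ : (f g : ℕ → ℕ) → Set
f =Ω√ g = ∃[ c ] 0ℚᵘ < c ×
  (∃[ s₀ ] ∀ s → s₀ ℕ.≤ s → (c * c) * fromℕ (g s) ≤ fromℕ (f s) * fromℕ (f s))

{-# OPTIONS --safe #-}
module Submission where

open import Data.Bool.Base using (Bool; true; false; not; _∧_; _xor_)
open import Data.Bool.Properties using (xor-assoc; xor-comm; xor-same; not-involutive; ∧-conicalˡ; ∧-conicalʳ; T-≡; T?)
import Data.Bool.Properties as Bool
open import Data.Fin.Base using (Fin; zero; suc)
open import Data.Fin.Properties using (suc-injective)
import Data.Fin.Subset as Subset
open import Data.Fin.Subset using (Subset; inside; outside; ∣_∣)
open import Data.Fin.Subset.Properties using (anySubset?)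
import Data.Integer.Base as ℤ
import Data.Integer.Properties as ℤ
open import Data.List.Base using (List; []; _∷_; _++_; map; length; cartesianProductWith; cartesianProduct; filterᵇ)
open import Data.List.Membership.Propositional using (_∈_)
open import Data.List.Membership.Propositional.Properties using (∈-map⁺; ∈-++⁺ˡ; ∈-++⁺ʳ; ∈-filter⁺)
open import Data.List.Properties using (map-++; map-∘; length-map; length-++)
open import Data.List.Relation.Unary.All as All using (All; []; _∷_)
import Data.List.Relation.Unary.All.Properties as All
open import Data.List.Relation.Unary.AllPairs using (AllPairs; []; _∷_)
open import Data.List.Relation.Unary.Any using (here)
open import Data.Nat.Base hiding (_/_)
open import Data.Nat.ListAction using (sum)
open import Data.Nat.ListAction.Properties using (sum-++)
open import Data.Nat.Properties hiding (suc-injective)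
open import Data.Nat.Tactic.RingSolver using (solve-∀)
open import Data.Product.Base using (∃-syntax; _×_; _,_; proj₁; proj₂)
open import Data.Rational.Unnormalised.Base as ℚᵘ using (_/_; *≤*; *<*)
open import Data.Sum.Base using (_⊎_; inj₁; inj₂)
open import Data.Vec.Base using (Vec; []; _∷_; zipWith; lookup; here; there)
open import Function.Base using (_∘_)
open import Function.Bundles using (Equivalence)
open import Relation.Binary.PropositionalEquality
open import Relation.Nullary using (¬_; yes; no; contradiction)
open import Defs using (EdgeColouring; colour; symmetric; IsMonochromatic; Arrows; r; r-isRamseyNumber; fromℕ; _=Ω√_)

-- Give each vertex v of an ordered vertex set a pair of vectors α(v), β(v) over 𝔽₂ in
-- dimension s − 2 with α(v) · β(v) = 0, and join u < v if α(u) · β(v) = 1.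
-- In a clique v₁ < … < vₖ the vector β(vᵢ) + β(vᵢ₊₁) is orthogonal to α(v₁), …, α(vᵢ₋₁)
-- but not to α(vᵢ), so α(v₁), …, α(vₖ₋₁) are linearly independent and k ≤ s − 1.
-- On the other hand only the values for u < v are constrained, so an independent set is not
-- confined to a small subspace: for random pairs an s-set is independent with probability
-- at most 16ˢ 2^(−s(s−1)/2), about what it would be in a uniformly random graph.
-- Colour an edge by the first of ℓ − 1 such random graphs containing it, and by the last
-- colour if there is none.  The first ℓ − 1 colours never contain a clique of size s, and by
-- the union bound the last one does not either as long as nˢ (16ˢ 2^(−s(s−1)/2))^(ℓ−1) < 1.

-- Finite sums over lists, averaging and indicator functions.

private
  variable
    A B C : Set

∑ : List A → (A → ℕ) → ℕ
∑ xs g = sum (map g xs)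

∑-cong : ∀ (xs : List A) {g h} → (∀ x → g x ≡ h x) → ∑ xs g ≡ ∑ xs h
∑-cong []       e = refl
∑-cong (x ∷ xs) e = cong₂ _+_ (e x) (∑-cong xs e)

∑-mono-≤ : ∀ (xs : List A) {g h} → (∀ x → g x ≤ h x) → ∑ xs g ≤ ∑ xs h
∑-mono-≤ []       e = z≤n
∑-mono-≤ (x ∷ xs) e = +-mono-≤ (e x) (∑-mono-≤ xs e)

∑-distrib-+ : ∀ (xs : List A) g h → ∑ xs (λ x → g x + h x) ≡ ∑ xs g + ∑ xs h
∑-distrib-+ []       g h = refl
∑-distrib-+ (x ∷ xs) g h = trans (cong (g x + h x +_) (∑-distrib-+ xs g h)) (shuffle (g x) (h x) _ _)
  where
  shuffle : ∀ a b c d → a + b + (c + d) ≡ a + c + (b + d)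
  shuffle = solve-∀

∑-distrib-* : ∀ c (xs : List A) g → ∑ xs (λ x → c * g x) ≡ c * ∑ xs g
∑-distrib-* c []       g = sym (*-zeroʳ c)
∑-distrib-* c (x ∷ xs) g = trans (cong (c * g x +_) (∑-distrib-* c xs g)) (sym (*-distribˡ-+ c (g x) _))

∑-const : ∀ (xs : List A) c → ∑ xs (λ _ → c) ≡ length xs * c
∑-const []       c = refl
∑-const (x ∷ xs) c = cong (c +_) (∑-const xs c)

∑-swap : ∀ (xs : List A) (ys : List B) (g : A → B → ℕ) →
         ∑ xs (λ x → ∑ ys (g x)) ≡ ∑ ys (λ y → ∑ xs (λ x → g x y))
∑-swap []       ys g = sym (trans (∑-const ys 0) (*-zeroʳ (length ys)))
∑-swap (x ∷ xs) ys g = trans (cong (∑ ys (g x) +_) (∑-swap xs ys g))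
  (sym (∑-distrib-+ ys (g x) (λ y → ∑ xs (λ x′ → g x′ y))))

∑-cartesianProductWith : ∀ (f : A → B → C) xs ys g →
  ∑ (cartesianProductWith f xs ys) g ≡ ∑ xs (λ x → ∑ ys (λ y → g (f x y)))
∑-cartesianProductWith f []       ys g = refl
∑-cartesianProductWith f (x ∷ xs) ys g = begin
  sum (map g (map (f x) ys ++ cartesianProductWith f xs ys))
    ≡⟨ cong sum (map-++ g (map (f x) ys) _) ⟩
  sum (map g (map (f x) ys) ++ map g (cartesianProductWith f xs ys))
    ≡⟨ sum-++ (map g (map (f x) ys)) _ ⟩
  sum (map g (map (f x) ys)) + ∑ (cartesianProductWith f xs ys) g
    ≡⟨ cong₂ _+_ (cong sum (sym (map-∘ ys))) (∑-cartesianProductWith f xs ys g) ⟩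
  ∑ ys (λ y → g (f x y)) + ∑ xs (λ x → ∑ ys (λ y → g (f x y))) ∎
  where open ≡-Reasoning

length-cartesianProductWith : ∀ (f : A → B → C) xs ys →
  length (cartesianProductWith f xs ys) ≡ length xs * length ys
length-cartesianProductWith f xs ys = begin
  length (cartesianProductWith f xs ys)
    ≡⟨ *-identityʳ _ ⟨
  length (cartesianProductWith f xs ys) * 1
    ≡⟨ ∑-const (cartesianProductWith f xs ys) 1 ⟨
  ∑ (cartesianProductWith f xs ys) (λ _ → 1)
    ≡⟨ ∑-cartesianProductWith f xs ys (λ _ → 1) ⟩
  ∑ xs (λ _ → ∑ ys (λ _ → 1))
    ≡⟨ ∑-const xs _ ⟩
  length xs * ∑ ys (λ _ → 1)
    ≡⟨ cong (length xs *_) (trans (∑-const ys 1) (*-identityʳ _)) ⟩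
  length xs * length ys ∎
  where open ≡-Reasoning

-- The first-moment method. An entry whose value exceeds K can be removed from both sides without
-- spoiling the inequality, so the search goes on in the tail; for a single remaining entry the
-- inequality is the claim itself.
∃-≤-mean : ∀ (xs : List A) g K → 0 < length xs → ∑ xs g ≤ length xs * K → ∃[ x ] g x ≤ K
∃-≤-mean (x ∷ xs) g K _ = go x xs
  where
  go : ∀ x xs → ∑ (x ∷ xs) g ≤ length (x ∷ xs) * K → ∃[ y ] g y ≤ K
  go x [] le = x , ≤-trans (m≤m+n (g x) 0) (≤-trans le (≤-reflexive (+-identityʳ K)))
  go x (y ∷ xs) le with g x ≤? K
  ... | yes gx≤K = x , gx≤K
  ... | no  gx≰K = go y xs (+-cancelˡ-≤ K _ _ (≤-trans (+-monoˡ-≤ _ (<⇒≤ (≰⇒> gx≰K))) le))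

indicator : Bool → ℕ
indicator true  = 1
indicator false = 0

indicator≤1 : ∀ x → indicator x ≤ 1
indicator≤1 true  = ≤-refl
indicator≤1 false = z≤n

indicator-∧ : ∀ x y → indicator (x ∧ y) ≡ indicator x * indicator y
indicator-∧ true  y = sym (+-identityʳ _)
indicator-∧ false y = refl

length-filterᵇ : ∀ (p : A → Bool) xs → length (filterᵇ p xs) ≡ ∑ xs (λ x → indicator (p x))
length-filterᵇ p [] = refl
length-filterᵇ p (x ∷ xs) with p x
... | true  = cong suc (length-filterᵇ p xs)
... | false = length-filterᵇ p xs

-- Probabilities are treated as counts over explicit lists of outcomes. This one serves twice: for
-- 𝔽₂ᵗ and for the assignments of points to n vertices.
vectors : List A → ∀ n → List (Vec A n)
vectors xs zero    = [] ∷ []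
vectors xs (suc n) = cartesianProductWith _∷_ xs (vectors xs n)

length-vectors : ∀ (xs : List A) n → length (vectors xs n) ≡ length xs ^ n
length-vectors xs zero    = refl
length-vectors xs (suc n) = trans (length-cartesianProductWith _∷_ xs (vectors xs n))
                                  (cong (length xs *_) (length-vectors xs n))

-- Linear algebra over 𝔽₂

cube : ∀ t → List (Vec Bool t)
cube = vectors (false ∷ true ∷ [])

∑-cube-suc : ∀ t (g : Vec Bool (suc t) → ℕ) →
  ∑ (cube (suc t)) g ≡ ∑ (cube t) (g ∘ (false ∷_)) + ∑ (cube t) (g ∘ (true ∷_))
∑-cube-suc t g = trans (∑-cartesianProductWith _∷_ (false ∷ true ∷ []) (cube t) g)
                       (cong (∑ (cube t) (g ∘ (false ∷_)) +_) (+-identityʳ _))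

infixl 6 _⊕_

_⊕_ : ∀ {t} → Vec Bool t → Vec Bool t → Vec Bool t
_⊕_ = zipWith _xor_

infix 7 _·_

_·_ : ∀ {t} → Vec Bool t → Vec Bool t → Bool
[]      · []      = false
(x ∷ a) · (y ∷ b) = (x ∧ y) xor (a · b)

·-⊕ : ∀ {t} (a b c : Vec Bool t) → a · (b ⊕ c) ≡ (a · b) xor (a · c)
·-⊕ []      []      []      = refl
·-⊕ (x ∷ a) (y ∷ b) (z ∷ c) rewrite ·-⊕ a b c = shuffle x y z (a · b) (a · c)
  where
  shuffle : ∀ x y z u v → (x ∧ (y xor z)) xor (u xor v) ≡ ((x ∧ y) xor u) xor ((x ∧ z) xor v)
  shuffle false y     z     u v = refl
  shuffle true  false z     u v = trans (sym (xor-assoc z u v))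
    (trans (cong (_xor v) (xor-comm z u)) (xor-assoc u z v))
  shuffle true  true  false u v = sym (xor-assoc true u v)
  shuffle true  true  true  false v = sym (not-involutive v)
  shuffle true  true  true  true  v = refl

-- Each coordinate of c either preserves the two halves of the cube or exchanges them.
∑-translate : ∀ {t} (c : Vec Bool t) (g : Vec Bool t → ℕ) →
  ∑ (cube t) (λ b → g (b ⊕ c)) ≡ ∑ (cube t) g
∑-translate []                g = refl
∑-translate {suc t} (false ∷ c) g = trans (∑-cube-suc t _)
  (trans (cong₂ _+_ (∑-translate c (g ∘ (false ∷_))) (∑-translate c (g ∘ (true ∷_)))) (sym (∑-cube-suc t g)))
∑-translate {suc t} (true ∷ c) g = trans (∑-cube-suc t _)
  (trans (cong₂ _+_ (∑-translate c (g ∘ (true ∷_))) (∑-translate c (g ∘ (false ∷_))))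
    (trans (+-comm (∑ (cube t) (g ∘ (true ∷_))) _) (sym (∑-cube-suc t g))))

isZero : ∀ {t} → Vec Bool t → Bool
isZero []      = true
isZero (x ∷ a) = not x ∧ isZero a

∑-isZero : ∀ t → ∑ (cube t) (λ b → indicator (isZero b)) ≡ 1
∑-isZero zero    = refl
∑-isZero (suc t) = trans (∑-cube-suc t _)
  (cong₂ _+_ (∑-isZero t) (trans (∑-const (cube t) 0) (*-zeroʳ (length (cube t)))))

∑-indicator-split : ∀ (xs : List A) (p : A → Bool) →
  ∑ xs (λ x → indicator (not (p x))) + ∑ xs (λ x → indicator (p x)) ≡ length xs
∑-indicator-split xs p = trans (sym (∑-distrib-+ xs _ _))
  (trans (∑-cong xs (λ x → one (p x))) (trans (∑-const xs 1) (*-identityʳ _)))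
  where
  one : ∀ y → indicator (not y) + indicator y ≡ 1
  one true  = refl
  one false = refl

length-cube : ∀ t → length (cube t) ≡ 2 ^ t
length-cube = length-vectors (false ∷ true ∷ [])

-- A nonzero b is orthogonal to exactly half of the cube, and b = 0 to all of it. At a coordinate
-- where b is 1, flipping that coordinate of a flips the product, so the two halves together count
-- every shorter vector once.
2*∑-·-≡-0 : ∀ {t} (b : Vec Bool t) →
  2 * ∑ (cube t) (λ a → indicator (not (a · b))) ≡ 2 ^ t + 2 ^ t * indicator (isZero b)
2*∑-·-≡-0 [] = refl
2*∑-·-≡-0 {suc t} (false ∷ b) = begin
  2 * ∑ (cube (suc t)) (λ a → indicator (not (a · (false ∷ b))))
    ≡⟨ cong (2 *_) (∑-cube-suc t _) ⟩
  2 * (z + z)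
    ≡⟨ *-distribˡ-+ 2 z z ⟩
  2 * z + 2 * z
    ≡⟨ cong (λ w → w + w) (2*∑-·-≡-0 b) ⟩
  (2 ^ t + 2 ^ t * i) + (2 ^ t + 2 ^ t * i)
    ≡⟨ double (2 ^ t) i ⟩
  2 ^ suc t + 2 ^ suc t * i ∎
  where
  open ≡-Reasoning
  z = ∑ (cube t) (λ a → indicator (not (a · b)))
  i = indicator (isZero b)
  double : ∀ p i → (p + p * i) + (p + p * i) ≡ 2 * p + 2 * p * i
  double = solve-∀
2*∑-·-≡-0 {suc t} (true ∷ b) = begin
  2 * ∑ (cube (suc t)) (λ a → indicator (not (a · (true ∷ b))))
    ≡⟨ cong (2 *_) (∑-cube-suc t _) ⟩
  2 * (∑ (cube t) (λ a → indicator (not (a · b))) + ∑ (cube t) (λ a → indicator (not (not (a · b)))))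
    ≡⟨ cong (λ w → 2 * (∑ (cube t) (λ a → indicator (not (a · b))) + w))
            (∑-cong (cube t) (λ a → cong indicator (not-involutive (a · b)))) ⟩
  2 * (∑ (cube t) (λ a → indicator (not (a · b))) + ∑ (cube t) (λ a → indicator (a · b)))
    ≡⟨ cong (2 *_) (trans (∑-indicator-split (cube t) (_· b)) (length-cube t)) ⟩
  2 ^ suc t
    ≡⟨ trans (cong (2 ^ suc t +_) (*-zeroʳ (2 ^ suc t))) (+-identityʳ _) ⟨
  2 ^ suc t + 2 ^ suc t * 0 ∎
  where open ≡-Reasoning

inPerp : ∀ {t} → List (Vec Bool t) → Vec Bool t → Bool
inPerp []       b = true
inPerp (a ∷ as) b = not (a · b) ∧ inPerp as b

-- This is 2 to the power t minus the rank of `as`. Counting the orthogonal complement takes the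
-- place of ranks and bases throughout.
perpSize : ∀ {t} → List (Vec Bool t) → ℕ
perpSize {t} as = ∑ (cube t) (λ b → indicator (inPerp as b))

perpSize-[] : ∀ t → perpSize {t} [] ≡ 2 ^ t
perpSize-[] t = trans (∑-const (cube t) 1) (trans (*-identityʳ _) (length-cube t))

inPerp-⊕ : ∀ {t} (as : List (Vec Bool t)) b c → inPerp as c ≡ true → inPerp as (b ⊕ c) ≡ inPerp as b
inPerp-⊕ []       b c _ = refl
inPerp-⊕ (a ∷ as) b c e with a · c in eq
... | false = cong₂ (λ x y → not x ∧ y)
  (trans (·-⊕ a b c) (trans (cong ((a · b) xor_) eq) (xor-comm (a · b) false)))
  (inPerp-⊕ as b c e)

perpSize-split : ∀ {t} (a : Vec Bool t) as →
  perpSize (a ∷ as) + ∑ (cube t) (λ b → indicator ((a · b) ∧ inPerp as b)) ≡ perpSize as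
perpSize-split {t} a as = trans (sym (∑-distrib-+ (cube t) _ _))
  (∑-cong (cube t) (λ b → split (a · b) (inPerp as b)))
  where
  split : ∀ x y → indicator (not x ∧ y) + indicator (x ∧ y) ≡ indicator y
  split true  y = refl
  split false y = +-identityʳ _

-- A functional which does not vanish on as⊥ takes both values equally often there:
-- translation by a vector c of as⊥ with a · c = 1 exchanges the two fibres.
perpSize-half : ∀ {t} (a : Vec Bool t) as c → inPerp as c ≡ true → a · c ≡ true →
  2 * perpSize (a ∷ as) ≡ perpSize as
perpSize-half {t} a as c c∈ ac = trans (cong (perpSize (a ∷ as) +_) (trans (+-identityʳ _) exchange)) (perpSize-split a as)
  where
  exchange : perpSize (a ∷ as) ≡ ∑ (cube t) (λ b → indicator ((a · b) ∧ inPerp as b))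
  exchange = trans (sym (∑-translate c _)) (∑-cong (cube t) λ b → cong indicator (cong₂ _∧_
    (trans (cong not (trans (·-⊕ a b c) (trans (cong ((a · b) xor_) ac) (xor-comm (a · b) true)))) (not-involutive _))
    (inPerp-⊕ as b c c∈)))

-- Either some c in as⊥ has a · c = 1, and `perpSize-half` applies, or the new condition holds on
-- all of as⊥ already. The alternative is decided by exhaustive search, a `Subset t` being a
-- `Vec Bool t`.
perpSize-∷ : ∀ {t} (a : Vec Bool t) as →
  perpSize (a ∷ as) ≡ perpSize as ⊎ 2 * perpSize (a ∷ as) ≡ perpSize as
perpSize-∷ {t} a as with anySubset? (λ c → (inPerp as c ∧ (a · c)) Bool.≟ true)
... | yes (c , e) = inj₂ (perpSize-half a as c (∧-conicalˡ _ _ e) (∧-conicalʳ _ _ e))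
... | no none     = inj₁ (∑-cong (cube t) λ b → cong indicator (vanish (a · b) (inPerp as b) (λ e → none (b , e))))
  where
  vanish : ∀ x y → (y ∧ x ≢ true) → not x ∧ y ≡ y
  vanish false y     _ = refl
  vanish true  false _ = refl
  vanish true  true  e = contradiction refl e

inPerp-0 : ∀ {t} (as : List (Vec Bool t)) b → isZero b ≡ true → inPerp as b ≡ true
inPerp-0 []       b _ = refl
inPerp-0 (a ∷ as) b e = cong₂ _∧_ (cong not (·-0 a b e)) (inPerp-0 as b e)
  where
  ·-0 : ∀ {t} (a b : Vec Bool t) → isZero b ≡ true → a · b ≡ false
  ·-0 []          []          _ = refl
  ·-0 (false ∷ a) (false ∷ b) e = ·-0 a b e
  ·-0 (true ∷ a)  (false ∷ b) e = ·-0 a b e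

0<perpSize : ∀ {t} (as : List (Vec Bool t)) → 0 < perpSize as
0<perpSize {t} as = ≤-trans (≤-reflexive (sym (∑-isZero t))) (∑-mono-≤ (cube t) λ b → le b)
  where
  le : ∀ b → indicator (isZero b) ≤ indicator (inPerp as b)
  le b with isZero b in eq
  ... | false = z≤n
  ... | true rewrite inPerp-0 as b eq = ≤-refl

-- By perpSize-∷ the subtraction never truncates: the value is perpSize as if a vanishes on
-- as⊥ and 0 otherwise.
excess : ∀ {t} → List (Vec Bool t) → Vec Bool t → ℕ
excess as a = 2 * perpSize (a ∷ as) ∸ perpSize as

perpSize+excess : ∀ {t} (as : List (Vec Bool t)) a → perpSize as + excess as a ≡ 2 * perpSize (a ∷ as)
perpSize+excess as a = m+[n∸m]≡n (le (perpSize-∷ a as))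
  where
  le : perpSize (a ∷ as) ≡ perpSize as ⊎ 2 * perpSize (a ∷ as) ≡ perpSize as → perpSize as ≤ 2 * perpSize (a ∷ as)
  le (inj₁ e) = ≤-trans (≤-reflexive (sym e)) (m≤m+n _ _)
  le (inj₂ e) = ≤-reflexive (sym e)

-- Double counting of the pairs (a , b) with b in as⊥ and a · b = 0. Each b is orthogonal to half of
-- all a, and b = 0 to the other half as well, which is the only surplus. Since `excess` is
-- supported on the span of `as`, this says that few a lie in that span.
∑-excess : ∀ {t} (as : List (Vec Bool t)) → ∑ (cube t) (excess as) ≤ 2 ^ t
∑-excess {t} as = +-cancelˡ-≤ (2 ^ t * perpSize as) _ _ (begin
  2 ^ t * perpSize as + ∑ (cube t) (excess as)
    ≡⟨ cong (λ l → l * perpSize as + ∑ (cube t) (excess as)) (length-cube t) ⟨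
  length (cube t) * perpSize as + ∑ (cube t) (excess as)
    ≡⟨ cong (_+ ∑ (cube t) (excess as)) (∑-const (cube t) (perpSize as)) ⟨
  ∑ (cube t) (λ _ → perpSize as) + ∑ (cube t) (excess as)
    ≡⟨ ∑-distrib-+ (cube t) _ _ ⟨
  ∑ (cube t) (λ a → perpSize as + excess as a)
    ≡⟨ ∑-cong (cube t) (perpSize+excess as) ⟩
  ∑ (cube t) (λ a → 2 * perpSize (a ∷ as))
    ≡⟨ ∑-cong (cube t) (λ a → sym (∑-distrib-* 2 (cube t) _)) ⟩
  ∑ (cube t) (λ a → ∑ (cube t) (λ b → 2 * indicator (not (a · b) ∧ inPerp as b)))
    ≡⟨ ∑-swap (cube t) (cube t) _ ⟩
  ∑ (cube t) (λ b → ∑ (cube t) (λ a → 2 * indicator (not (a · b) ∧ inPerp as b)))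
    ≡⟨ ∑-cong (cube t) column ⟩
  ∑ (cube t) (λ b → indicator (inPerp as b) * (2 ^ t + 2 ^ t * indicator (isZero b)))
    ≤⟨ ∑-mono-≤ (cube t) (λ b → bound (indicator (inPerp as b)) (2 ^ t) (indicator (isZero b)) (indicator≤1 (inPerp as b))) ⟩
  ∑ (cube t) (λ b → 2 ^ t * indicator (inPerp as b) + 2 ^ t * indicator (isZero b))
    ≡⟨ ∑-distrib-+ (cube t) _ _ ⟩
  ∑ (cube t) (λ b → 2 ^ t * indicator (inPerp as b)) + ∑ (cube t) (λ b → 2 ^ t * indicator (isZero b))
    ≡⟨ cong₂ _+_ (∑-distrib-* (2 ^ t) (cube t) _) (∑-distrib-* (2 ^ t) (cube t) _) ⟩
  2 ^ t * perpSize as + 2 ^ t * ∑ (cube t) (λ b → indicator (isZero b))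
    ≡⟨ cong (2 ^ t * perpSize as +_) (trans (cong (2 ^ t *_) (∑-isZero t)) (*-identityʳ _)) ⟩
  2 ^ t * perpSize as + 2 ^ t ∎)
  where
  open ≤-Reasoning
  shuffle : ∀ x y → 2 * (x * y) ≡ (2 * y) * x
  shuffle = solve-∀
  shuffle′ : ∀ x y → 2 * x * y ≡ x * (2 * y)
  shuffle′ = solve-∀
  column : ∀ b → ∑ (cube t) (λ a → 2 * indicator (not (a · b) ∧ inPerp as b)) ≡
                 indicator (inPerp as b) * (2 ^ t + 2 ^ t * indicator (isZero b))
  column b = trans
    (∑-cong (cube t) λ a → trans (cong (2 *_) (indicator-∧ (not (a · b)) (inPerp as b)))
                                 (shuffle (indicator (not (a · b))) (indicator (inPerp as b))))
    (trans (∑-distrib-* (2 * indicator (inPerp as b)) (cube t) _)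
      (trans (shuffle′ (indicator (inPerp as b)) _) (cong (indicator (inPerp as b) *_) (2*∑-·-≡-0 b))))
  expand : ∀ i p z → i * (p + p * z) ≡ p * i + i * (p * z)
  expand = solve-∀
  bound : ∀ i p z → i ≤ 1 → i * (p + p * z) ≤ p * i + p * z
  bound i p z i≤1 = ≤-trans (≤-reflexive (expand i p z))
    (+-monoʳ-≤ (p * i) (≤-trans (*-monoˡ-≤ (p * z) i≤1) (≤-reflexive (+-identityʳ _))))

-- Subsets as sublists, and graphs on an ordered vertex set.

select : ∀ {n} → Subset n → Vec A n → List A
select []            []       = []
select (outside ∷ S) (x ∷ xs) = select S xs
select (inside ∷ S)  (x ∷ xs) = x ∷ select S xs

length-select : ∀ {n} (S : Subset n) (xs : Vec A n) → length (select S xs) ≡ ∣ S ∣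
length-select []            []       = refl
length-select (outside ∷ S) (x ∷ xs) = length-select S xs
length-select (inside ∷ S)  (x ∷ xs) = cong suc (length-select S xs)

select-All : ∀ {n} {P : A → Set} (S : Subset n) (xs : Vec A n) →
  (∀ i → i Subset.∈ S → P (lookup xs i)) → All P (select S xs)
select-All []            []       p = []
select-All (outside ∷ S) (x ∷ xs) p = select-All S xs λ i i∈ → p (suc i) (there i∈)
select-All (inside ∷ S)  (x ∷ xs) p = p zero here ∷ select-All S xs λ i i∈ → p (suc i) (there i∈)

-- The earlier entry is always the first argument of φ, so a φ that is not symmetric still yields an
-- undirected graph. This is where the order of the vertices enters.
onPairs : ∀ {n} → (A → A → Bool) → Vec A n → Fin n → Fin n → Bool
onPairs φ (x ∷ xs) zero    zero    = false
onPairs φ (x ∷ xs) zero    (suc j) = φ x (lookup xs j)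
onPairs φ (x ∷ xs) (suc i) zero    = φ x (lookup xs i)
onPairs φ (x ∷ xs) (suc i) (suc j) = onPairs φ xs i j

onPairs-sym : ∀ {n} (φ : A → A → Bool) (xs : Vec A n) i j → onPairs φ xs i j ≡ onPairs φ xs j i
onPairs-sym φ (x ∷ xs) zero    zero    = refl
onPairs-sym φ (x ∷ xs) zero    (suc j) = refl
onPairs-sym φ (x ∷ xs) (suc i) zero    = refl
onPairs-sym φ (x ∷ xs) (suc i) (suc j) = onPairs-sym φ xs i j

select-AllPairs : ∀ {n} (φ : A → A → Bool) v (S : Subset n) (xs : Vec A n) →
  (∀ i j → i Subset.∈ S → j Subset.∈ S → i ≢ j → onPairs φ xs i j ≡ v) →
  AllPairs (λ x y → φ x y ≡ v) (select S xs)
select-AllPairs φ v []            []       p = []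
select-AllPairs φ v (outside ∷ S) (x ∷ xs) p = select-AllPairs φ v S xs
  λ i j i∈ j∈ i≢j → p (suc i) (suc j) (there i∈) (there j∈) (i≢j ∘ suc-injective)
select-AllPairs φ v (inside ∷ S)  (x ∷ xs) p =
  select-All S xs (λ j j∈ → p zero (suc j) here (there j∈) (λ ()))
  ∷ select-AllPairs φ v S xs
      λ i j i∈ j∈ i≢j → p (suc i) (suc j) (there i∈) (there j∈) (i≢j ∘ suc-injective)

-- Ordered orthogonality graphs

Point : ℕ → Set
Point t = Vec Bool t × Vec Bool t

points : ∀ t → List (Point t)
points t = cartesianProduct (cube t) (cube t)

length-points : ∀ t → length (points t) ≡ 2 ^ t * 2 ^ t
length-points t = trans (length-cartesianProductWith _,_ (cube t) (cube t)) (cong₂ _*_ (length-cube t) (length-cube t))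

-- The extra coordinate makes α x · β x vanish for every pair (a , b).
α β : ∀ {t} → Point t → Vec Bool (suc t)
α (a , b) = true ∷ a
β (a , b) = a · b ∷ b

form : ∀ {t} → Point t → Point t → Bool
form x y = α x · β y

form-diag : ∀ {t} (x : Point t) → form x x ≡ false
form-diag (a , b) = xor-same (a · b)

-- Here `as` holds the α of the earlier clique vertices. With y the vertex after x, `β x ⊕ β y` is
-- orthogonal to `as`, both products being 1, while its product with `α x` is 0 + 1. So each vertex
-- but the last halves the complement, which never becomes empty because it contains 0.
clique-bound : ∀ {t} as (x : Point t) xs →
  All (λ y → All (λ a → a · β y ≡ true) as) (x ∷ xs) →
  AllPairs (λ x y → form x y ≡ true) (x ∷ xs) →
  2 ^ length xs ≤ perpSize as
clique-bound as x []       _                 _                          = 0<perpSize as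
clique-bound as x (y ∷ ys) (1x ∷ 1y ∷ 1ys) ((xy ∷ xys) ∷ pairs) = begin
  2 * 2 ^ length ys          ≤⟨ *-monoʳ-≤ 2 (clique-bound (α x ∷ as) y ys ((xy ∷ 1y) ∷ extend xys 1ys) pairs) ⟩
  2 * perpSize (α x ∷ as)    ≡⟨ perpSize-half (α x) as (β x ⊕ β y) (differ as 1x 1y)
                                  (trans (·-⊕ (α x) (β x) (β y)) (cong₂ _xor_ (form-diag x) xy)) ⟩
  perpSize as                ∎
  where
  open ≤-Reasoning
  extend : ∀ {zs} → All (λ z → form x z ≡ true) zs → All (λ z → All (λ a → a · β z ≡ true) as) zs →
           All (λ z → All (λ a → a · β z ≡ true) (α x ∷ as)) zs
  extend p q = All.zipWith (λ (e , es) → e ∷ es) (p , q)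
  differ : ∀ as → All (λ a → a · β x ≡ true) as → All (λ a → a · β y ≡ true) as →
           inPerp as (β x ⊕ β y) ≡ true
  differ []       []       []       = refl
  differ (a ∷ as) (p ∷ ps) (q ∷ qs) =
    cong₂ _∧_ (cong not (trans (·-⊕ a (β x) (β y)) (cong₂ _xor_ p q))) (differ as ps qs)

-- Counting the assignments for which a given set is independent.

independent : ∀ {t} → List (Vec Bool (suc t)) → List (Point t) → Bool
independent as []       = true
independent as (x ∷ xs) = inPerp as (β x) ∧ independent (α x ∷ as) xs

AllPairs⇒independent : ∀ {t} as (xs : List (Point t)) →
  All (λ x → inPerp as (β x) ≡ true) xs → AllPairs (λ x y → form x y ≡ false) xs →
  independent as xs ≡ true
AllPairs⇒independent as []       _        _            = refl
AllPairs⇒independent as (x ∷ xs) (p ∷ ps) (q ∷ pairs) = cong₂ _∧_ p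
  (AllPairs⇒independent (α x ∷ as) xs
    (All.zipWith (λ (e , e′) → cong₂ _∧_ (cong not e) e′) (q , ps)) pairs)

-- Divided by the number of all assignments, this is the probability that S is independent and that
-- every β of S is orthogonal to `as`. The parameter `as` makes room for induction: the vertices are
-- exposed in order, and `as` records the α of those already seen.
countIndependent : ∀ {t n} → List (Vec Bool (suc t)) → Subset n → ℕ
countIndependent {t} {n} as S =
  ∑ (vectors (points t) n) (λ f → indicator (independent as (select S f)))

countIndependent-outside : ∀ {t n} as (S : Subset n) →
  countIndependent {t} as (outside ∷ S) ≡ 2 ^ t * 2 ^ t * countIndependent {t} as S
countIndependent-outside {t} {n} as S =
  trans (∑-cartesianProductWith _∷_ (points t) (vectors (points t) n) _)
    (trans (∑-const (points t) _) (cong (_* countIndependent {t} as S) (length-points t)))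

-- α⊥ = { β (a , b) : b } for α = (1 , a).
∑-inPerp-β : ∀ {t} as (a : Vec Bool t) →
  ∑ (cube t) (λ b → indicator (inPerp as (β (a , b)))) ≡ perpSize ((true ∷ a) ∷ as)
∑-inPerp-β {t} as a = sym (trans (∑-cube-suc t _)
  (trans (sym (∑-distrib-+ (cube t) _ _)) (∑-cong (cube t) fibre)))
  where
  fibre : ∀ b → indicator (not (a · b) ∧ inPerp as (false ∷ b))
              + indicator (not (not (a · b)) ∧ inPerp as (true ∷ b)) ≡ indicator (inPerp as (a · b ∷ b))
  fibre b with a · b
  ... | true  = refl
  ... | false = +-identityʳ _

-- The first vertex (a , b) constrains the later ones only through a. For fixed a, the number of b
-- that put its β into as⊥ is given by `∑-inPerp-β`.
countIndependent-inside : ∀ {t n} as (S : Subset n) →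
  countIndependent {t} as (inside ∷ S) ≡
  ∑ (cube t) (λ a → countIndependent {t} ((true ∷ a) ∷ as) S * perpSize ((true ∷ a) ∷ as))
countIndependent-inside {t} {n} as S = begin
  countIndependent {t} as (inside ∷ S)
    ≡⟨ ∑-cartesianProductWith _∷_ (points t) (vectors (points t) n) _ ⟩
  ∑ (points t) (λ x → ∑ (vectors (points t) n) (λ f →
    indicator (inPerp as (β x) ∧ independent (α x ∷ as) (select S f))))
    ≡⟨ ∑-cong (points t) (λ x → trans
         (∑-cong (vectors (points t) n) (λ f → indicator-∧ (inPerp as (β x)) _))
         (∑-distrib-* (indicator (inPerp as (β x))) (vectors (points t) n) _)) ⟩
  ∑ (points t) (λ x → indicator (inPerp as (β x)) * countIndependent (α x ∷ as) S)
    ≡⟨ ∑-cartesianProductWith _,_ (cube t) (cube t) _ ⟩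
  ∑ (cube t) (λ a → ∑ (cube t) (λ b → indicator (inPerp as (β (a , b))) * countIndependent {t} ((true ∷ a) ∷ as) S))
    ≡⟨ ∑-cong (cube t) (λ a → trans
         (∑-cong (cube t) (λ b → *-comm (indicator (inPerp as (β (a , b)))) _))
         (trans (∑-distrib-* (countIndependent {t} ((true ∷ a) ∷ as) S) (cube t) _)
           (cong (countIndependent {t} ((true ∷ a) ∷ as) S *_) (∑-inPerp-β as a)))) ⟩
  ∑ (cube t) (λ a → countIndependent {t} ((true ∷ a) ∷ as) S * perpSize ((true ∷ a) ∷ as)) ∎
  where open ≡-Reasoning

-- The binomial coefficient s(s - 1)/2, the number of pairs in an s-set.
triangle : ℕ → ℕ
triangle zero    = 0
triangle (suc j) = j + triangle j

^-distribʳ-* : ∀ k m n → (m * n) ^ k ≡ m ^ k * n ^ k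
^-distribʳ-* zero    m n = refl
^-distribʳ-* (suc k) m n = trans (cong (m * n *_) (^-distribʳ-* k m n)) (shuffle m n (m ^ k) (n ^ k))
  where
  shuffle : ∀ m n x y → m * n * (x * y) ≡ m * x * (n * y)
  shuffle = solve-∀

-- With P = perpSize as, adding a vector α to as leaves P unchanged or halves it; the sum of
-- `excess` shows that the first case is too rare to matter as long as 2ʲ ≤ 4 P.
countIndependent-bound : ∀ {t n} as (S : Subset n) → 2 ^ ∣ S ∣ ≤ 4 * perpSize as →
  countIndependent {t} as S * (2 ^ t) ^ ∣ S ∣ * 2 ^ triangle ∣ S ∣ ≤
  (2 ^ t * 2 ^ t) ^ n * (8 * perpSize as) ^ ∣ S ∣
countIndependent-bound as [] _ = ≤-refl
countIndependent-bound {t} {suc n} as (outside ∷ S) le = begin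
  countIndependent {t} as (outside ∷ S) * x * y  ≡⟨ cong (λ c → c * x * y) (countIndependent-outside {t} as S) ⟩
  Q * c * x * y                              ≡⟨ assoc Q c x y ⟩
  Q * (c * x * y)                            ≤⟨ *-monoʳ-≤ Q (countIndependent-bound as S le) ⟩
  Q * (Q ^ n * (8 * perpSize as) ^ ∣ S ∣)     ≡⟨ *-assoc Q _ _ ⟨
  Q ^ suc n * (8 * perpSize as) ^ ∣ S ∣       ∎
  where
  open ≤-Reasoning
  Q = 2 ^ t * 2 ^ t
  c = countIndependent {t} as S
  x = (2 ^ t) ^ ∣ S ∣
  y = 2 ^ triangle ∣ S ∣
  assoc : ∀ Q c x y → Q * c * x * y ≡ Q * (c * x * y)
  assoc = solve-∀
-- The extra factor 2 completes 2 ^ j to 2 ^ suc j, so that the power of `2 * h a` appears, which is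
-- to be compared with P.
countIndependent-bound {t} {suc n} as (inside ∷ S) le = *-cancelˡ-≤ 2 (begin
  2 * (countIndependent {t} as (inside ∷ S) * (q * q ^ j) * 2 ^ (j + triangle j))
    ≡⟨ cong₂ (λ c p → 2 * (c * (q * q ^ j) * p)) (countIndependent-inside {t} as S) (^-distribˡ-+-* 2 j (triangle j)) ⟩
  2 * (∑ (cube t) term * (q * q ^ j) * (2 ^ j * 2 ^ triangle j))
    ≡⟨ shuffle₁ (∑ (cube t) term) q (q ^ j) (2 ^ j) (2 ^ triangle j) ⟩
  q * (w * ∑ (cube t) term)
    ≡⟨ cong (q *_) (∑-distrib-* w (cube t) term) ⟨
  q * ∑ (cube t) (λ a → w * term a)
    ≤⟨ *-monoʳ-≤ q (∑-mono-≤ (cube t) term-bound) ⟩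
  q * ∑ (cube t) (λ a → K * (P ^ suc j + 4 * P ^ suc j * excess as (true ∷ a)))
    ≡⟨ cong (q *_) (trans (∑-distrib-* K (cube t) _) (cong (K *_) (trans (∑-distrib-+ (cube t) _ _)
         (cong₂ _+_ (trans (∑-const (cube t) _) (cong (_* P ^ suc j) (length-cube t))) (∑-distrib-* (4 * P ^ suc j) (cube t) _))))) ⟩
  q * (K * (q * P ^ suc j + 4 * P ^ suc j * ∑ (cube t) (λ a → excess as (true ∷ a))))
    ≤⟨ *-monoʳ-≤ q (*-monoʳ-≤ K (+-monoʳ-≤ (q * P ^ suc j) (*-monoʳ-≤ (4 * P ^ suc j) excess-bound))) ⟩
  q * (K * (q * P ^ suc j + 4 * P ^ suc j * (2 * q)))
    ≡⟨ shuffle₂ q (Q ^ n) (8 ^ j) (P ^ suc j) ⟩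
  9 * (q * q * Q ^ n * (8 ^ j * P ^ suc j))
    -- The main term contributes 1 and the excess 4 · 2. That 9 is at most 2 · 8 is what the
    -- constant 8 per vertex allows for.
    ≤⟨ *-monoˡ-≤ (q * q * Q ^ n * (8 ^ j * P ^ suc j)) (m≤m+n 9 7) ⟩
  16 * (q * q * Q ^ n * (8 ^ j * P ^ suc j))
    ≡⟨ shuffle₃ (q * q * Q ^ n) (8 ^ j) (P ^ suc j) ⟩
  2 * (Q ^ suc n * (8 ^ suc j * P ^ suc j))
    ≡⟨ cong (λ p → 2 * (Q ^ suc n * p)) (^-distribʳ-* (suc j) 8 P) ⟨
  2 * (Q ^ suc n * (8 * P) ^ suc j) ∎)
  where
  open ≤-Reasoning
  q = 2 ^ t
  Q = q * q
  j = ∣ S ∣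
  P = perpSize as
  K = Q ^ n * 8 ^ j
  w = 2 * (q ^ j * 2 ^ triangle j * 2 ^ j)

  h : Vec Bool t → ℕ
  h a = perpSize ((true ∷ a) ∷ as)

  term : Vec Bool t → ℕ
  term a = countIndependent {t} ((true ∷ a) ∷ as) S * h a

  shuffle₁ : ∀ c q x y z → 2 * (c * (q * x) * (y * z)) ≡ q * (2 * (x * z * y) * c)
  shuffle₁ = solve-∀
  shuffle₂ : ∀ q N e p → q * (N * e * (q * p + 4 * p * (2 * q))) ≡ 9 * (q * q * N * (e * p))
  shuffle₂ = solve-∀
  shuffle₃ : ∀ N e p → 16 * (N * (e * p)) ≡ 2 * (N * (8 * e * p))
  shuffle₃ = solve-∀
  shuffle₄ : ∀ x y z c h → 2 * (x * y * z) * (c * h) ≡ c * x * y * (z * (2 * h))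
  shuffle₄ = solve-∀
  shuffle₅ : ∀ N x y z h → N * (x * y) * (z * (2 * h)) ≡ N * x * (2 * h * (z * y))
  shuffle₅ = solve-∀

  -- The vectors α fill the half of the cube of dimension t + 1 with first coordinate 1; the sum
  -- over the whole cube is bound enough.
  excess-bound : ∑ (cube t) (λ a → excess as (true ∷ a)) ≤ 2 * q
  excess-bound = ≤-trans (≤-trans (m≤n+m _ _) (≤-reflexive (sym (∑-cube-suc t (excess as))))) (∑-excess as)

  -- The hypothesis survives the induction: one vertex fewer halves the left side, and P drops at
  -- most by half.
  large : ∀ a → 2 ^ j ≤ 4 * h a
  large a = *-cancelˡ-≤ 2 (≤-trans le (≤-trans (*-monoʳ-≤ 4 P≤2h) (≤-reflexive (swap (h a)))))
    where
    P≤2h : P ≤ 2 * h a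
    P≤2h = ≤-trans (m≤m+n P _) (≤-reflexive (perpSize+excess as (true ∷ a)))
    swap : ∀ x → 4 * (2 * x) ≡ 2 * (4 * x)
    swap = solve-∀

  power-bound : ∀ a → (2 * h a) ^ suc j ≤ P ^ suc j + 4 * P ^ suc j * excess as (true ∷ a)
  power-bound a with perpSize-∷ (true ∷ a) as
  ... | inj₂ half = ≤-trans (≤-reflexive (cong (_^ suc j) half)) (m≤m+n _ _)
  -- Without halving, the power is too large by 2 ^ suc j. The hypothesis trades this factor for 4 *
  -- P, and here P is the excess.
  ... | inj₁ full = begin
    (2 * h a) ^ suc j                              ≡⟨ cong (λ x → (2 * x) ^ suc j) full ⟩
    (2 * P) ^ suc j                                ≡⟨ ^-distribʳ-* (suc j) 2 P ⟩
    2 ^ suc j * P ^ suc j                          ≤⟨ *-monoˡ-≤ (P ^ suc j) le ⟩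
    4 * P * P ^ suc j                              ≡⟨ swap P (P ^ suc j) ⟩
    4 * P ^ suc j * P                              ≡⟨ cong (4 * P ^ suc j *_) excess≡P ⟨
    4 * P ^ suc j * excess as (true ∷ a)           ≤⟨ m≤n+m _ _ ⟩
    P ^ suc j + 4 * P ^ suc j * excess as (true ∷ a) ∎
    where
    swap : ∀ x y → 4 * x * y ≡ 4 * y * x
    swap = solve-∀
    excess≡P : excess as (true ∷ a) ≡ P
    excess≡P = +-cancelˡ-≡ P _ _ (trans (perpSize+excess as (true ∷ a))
      (trans (cong (2 *_) full) (cong (P +_) (+-identityʳ P))))

  term-bound : ∀ a → w * term a ≤ K * (P ^ suc j + 4 * P ^ suc j * excess as (true ∷ a))
  term-bound a = begin
    w * term a
      ≡⟨ shuffle₄ (q ^ j) (2 ^ triangle j) (2 ^ j) (countIndependent {t} ((true ∷ a) ∷ as) S) (h a) ⟩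
    countIndependent {t} ((true ∷ a) ∷ as) S * q ^ j * 2 ^ triangle j * (2 ^ j * (2 * h a))
      ≤⟨ *-monoˡ-≤ (2 ^ j * (2 * h a)) (countIndependent-bound ((true ∷ a) ∷ as) S (large a)) ⟩
    Q ^ n * (8 * h a) ^ j * (2 ^ j * (2 * h a))
      ≡⟨ cong (λ x → Q ^ n * x * (2 ^ j * (2 * h a))) (^-distribʳ-* j 8 (h a)) ⟩
    Q ^ n * (8 ^ j * h a ^ j) * (2 ^ j * (2 * h a))
      ≡⟨ shuffle₅ (Q ^ n) (8 ^ j) (h a ^ j) (2 ^ j) (h a) ⟩
    K * (2 * h a * (2 ^ j * h a ^ j))
      ≡⟨ cong (λ x → K * (2 * h a * x)) (^-distribʳ-* j 2 (h a)) ⟨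
    K * (2 * h a) ^ suc j
      ≤⟨ *-monoʳ-≤ K (power-bound a) ⟩
    K * (P ^ suc j + 4 * P ^ suc j * excess as (true ∷ a)) ∎

-- In dimension t + 1 the initial P is 2 ^ (t + 1), so s = 3 + t meets the condition 2 ^ s ≤ 4 P
-- with equality. The base 8 P is 16 q with q = 2 ^ t, and q ^ s cancels.
countIndependent-[] : ∀ {s} t → s ≡ 3 + t → ∀ {n} (S : Subset n) → ∣ S ∣ ≡ s →
  countIndependent {t} [] S * 2 ^ triangle s ≤ (2 ^ t * 2 ^ t) ^ n * 16 ^ s
countIndependent-[] {s} t s≡3+t {n} S size = *-cancelʳ-≤ _ _ (q ^ s) (begin
  countIndependent {t} [] S * 2 ^ triangle s * q ^ s
    ≡⟨ swap (countIndependent {t} [] S) (2 ^ triangle s) (q ^ s) ⟩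
  countIndependent {t} [] S * q ^ s * 2 ^ triangle s
    ≤⟨ subst (λ j → 2 ^ j ≤ 4 * perpSize {suc t} [] →
               countIndependent {t} [] S * q ^ j * 2 ^ triangle j ≤ (q * q) ^ n * (8 * perpSize {suc t} []) ^ j)
             size (countIndependent-bound [] S) (≤-reflexive (trans (trans (cong (2 ^_) s≡3+t) (eight q)) (cong (4 *_) (sym (perpSize-[] (suc t)))))) ⟩
  (q * q) ^ n * (8 * perpSize {suc t} []) ^ s
    ≡⟨ cong (λ p → (q * q) ^ n * p ^ s) (trans (cong (8 *_) (perpSize-[] (suc t))) (sixteen q)) ⟩
  (q * q) ^ n * (16 * q) ^ s
    ≡⟨ cong ((q * q) ^ n *_) (^-distribʳ-* s 16 q) ⟩
  (q * q) ^ n * (16 ^ s * q ^ s)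
    ≡⟨ *-assoc ((q * q) ^ n) _ _ ⟨
  (q * q) ^ n * 16 ^ s * q ^ s ∎)
  where
  open ≤-Reasoning
  q = 2 ^ t
  instance
    q^s≢0 : NonZero (q ^ s)
    q^s≢0 = m^n≢0 q s {{m^n≢0 2 t}}
  swap : ∀ x y z → x * y * z ≡ x * z * y
  swap = solve-∀
  eight : ∀ q → 2 * (2 * (2 * q)) ≡ 4 * (2 * q)
  eight = solve-∀
  sixteen : ∀ q → 8 * (2 * q) ≡ 16 * q
  sixteen = solve-∀

-- The colouring

combinations : ∀ n → ℕ → List (Subset n)
combinations zero    zero    = [] ∷ []
combinations zero    (suc k) = []
combinations (suc n) zero    = map (outside ∷_) (combinations n zero)
combinations (suc n) (suc k) = map (inside ∷_) (combinations n k) ++ map (outside ∷_) (combinations n (suc k))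

∈-combinations : ∀ {n} (S : Subset n) {k} → ∣ S ∣ ≡ k → S ∈ combinations n k
∈-combinations []            refl = here refl
∈-combinations (inside ∷ S)  refl = ∈-++⁺ˡ (∈-map⁺ (inside ∷_) (∈-combinations S refl))
∈-combinations (outside ∷ S) {zero}  e = ∈-map⁺ (outside ∷_) (∈-combinations S e)
∈-combinations {suc n} (outside ∷ S) {suc k} e =
  ∈-++⁺ʳ (map (inside ∷_) (combinations n k)) (∈-map⁺ (outside ∷_) (∈-combinations S e))

combinations-size : ∀ n (k : ℕ) → All (λ S → ∣ S ∣ ≡ k) (combinations n k)
combinations-size zero    zero    = refl ∷ []
combinations-size zero    (suc k) = []
combinations-size (suc n) zero    = All.map⁺ (combinations-size n zero)
combinations-size (suc n) (suc k) =
  All.++⁺ (All.map⁺ (All.map (cong suc) (combinations-size n k))) (All.map⁺ (combinations-size n (suc k)))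

length-combinations : ∀ n (k : ℕ) → length (combinations n k) ≤ n ^ k
length-combinations zero    zero    = ≤-refl
length-combinations zero    (suc k) = z≤n
length-combinations (suc n) zero    =
  ≤-trans (≤-reflexive (length-map (outside ∷_) (combinations n zero))) (length-combinations n zero)
length-combinations (suc n) (suc k) = begin
  length (map (inside ∷_) (combinations n k) ++ map (outside ∷_) (combinations n (suc k)))
    ≡⟨ length-++ (map (inside ∷_) (combinations n k)) ⟩
  length (map (inside ∷_) (combinations n k)) + length (map (outside ∷_) (combinations n (suc k)))
    ≡⟨ cong₂ _+_ (length-map (inside ∷_) (combinations n k)) (length-map (outside ∷_) (combinations n (suc k))) ⟩
  length (combinations n k) + length (combinations n (suc k))
    ≤⟨ +-mono-≤ (length-combinations n k) (length-combinations n (suc k)) ⟩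
  suc n * n ^ k
    ≤⟨ *-monoʳ-≤ (suc n) (^-monoˡ-≤ k (n≤1+n n)) ⟩
  suc n ^ suc k ∎
  where open ≤-Reasoning

∑-All-≤ : ∀ {xs : List A} {g K} → All (λ x → g x ≤ K) xs → ∑ xs g ≤ length xs * K
∑-All-≤ []       = z≤n
∑-All-≤ (p ∷ ps) = +-mono-≤ p (∑-All-≤ ps)

-- Interchanging the sums bounds the mean number of independent members of `Ss` over all f, and some
-- f does no worse than the mean. Since `Ss` is an arbitrary list of s-sets, the graphs can be
-- chosen one after another instead of jointly.
∃-few-independent : ∀ {s} t → s ≡ 3 + t → ∀ {n} {Ss : List (Subset n)} → All (λ S → ∣ S ∣ ≡ s) Ss →
  ∃[ f ] length (filterᵇ (λ S → independent {t} [] (select S f)) Ss) * 2 ^ triangle s ≤ 16 ^ s * length Ss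
∃-few-independent {s} t s≡3+t {n} {Ss} sizes = ∃-≤-mean fs _ _ 0<length (begin
  ∑ fs (λ f → length (filterᵇ (λ S → independent [] (select S f)) Ss) * w)
    ≡⟨ ∑-cong fs (λ f → trans (*-comm _ w) (trans
         (cong (w *_) (length-filterᵇ (λ S → independent [] (select S f)) Ss))
         (sym (∑-distrib-* w Ss _)))) ⟩
  ∑ fs (λ f → ∑ Ss (λ S → w * indicator (independent [] (select S f))))
    ≡⟨ ∑-swap fs Ss (λ f S → w * indicator (independent [] (select S f))) ⟩
  ∑ Ss (λ S → ∑ fs (λ f → w * indicator (independent [] (select S f))))
    ≡⟨ ∑-cong Ss (λ S → trans (∑-distrib-* w fs _) (*-comm w _)) ⟩
  ∑ Ss (λ S → countIndependent {t} [] S * w)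
    ≤⟨ ∑-All-≤ (All.map (λ {S} → countIndependent-[] t s≡3+t S) sizes) ⟩
  length Ss * ((2 ^ t * 2 ^ t) ^ n * 16 ^ s)
    ≡⟨ shuffle (length Ss) ((2 ^ t * 2 ^ t) ^ n) (16 ^ s) ⟩
  (2 ^ t * 2 ^ t) ^ n * (16 ^ s * length Ss)
    ≡⟨ cong (_* (16 ^ s * length Ss)) length-fs ⟨
  length fs * (16 ^ s * length Ss) ∎)
  where
  open ≤-Reasoning
  fs = vectors (points t) n
  w = 2 ^ triangle s
  length-fs : length fs ≡ (2 ^ t * 2 ^ t) ^ n
  length-fs = trans (length-vectors (points t) n) (cong (_^ n) (length-points t))
  0<length : 0 < length fs
  0<length = subst (0 <_) (sym length-fs)
    (m^n>0 (2 ^ t * 2 ^ t) {{m*n≢0 _ _ {{m^n≢0 2 t}} {{m^n≢0 2 t}}}} n)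
  shuffle : ∀ x y z → x * (y * z) ≡ y * (z * x)
  shuffle = solve-∀

-- The state after m graphs. Colour `zero` marks the edges in none of them, the other colours belong
-- to the graphs. The list `survivors` contains every s-set that is still monochromatic in colour
-- `zero`; each graph cuts the bound on its length by the factor 16 ^ s / 2 ^ triangle s.
record Stage (s n m : ℕ) : Set where
  field
    colouring       : EdgeColouring n (suc m)
    noClique        : ∀ S k → ∣ S ∣ ≡ s → ¬ IsMonochromatic (colour colouring) (suc k) S
    survivors       : List (Subset n)
    survivors-size  : All (λ S → ∣ S ∣ ≡ s) survivors
    survivors-all   : ∀ S → ∣ S ∣ ≡ s → IsMonochromatic (colour colouring) zero S → S ∈ survivors
    survivors-few   : length survivors * (2 ^ triangle s) ^ m ≤ n ^ s * (16 ^ s) ^ m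

refine : ∀ {m} → Fin (suc m) → Bool → Fin (2 + m)
refine zero    false = zero
refine zero    true  = suc zero
refine (suc k) _     = suc (suc k)

refine-zero : ∀ {m} (k : Fin (suc m)) x → refine k x ≡ zero → k ≡ zero × x ≡ false
refine-zero zero false _ = refl , refl

refine-one : ∀ {m} (k : Fin (suc m)) x → refine k x ≡ suc zero → x ≡ true
refine-one zero true _ = refl

refine-suc : ∀ {m} (k : Fin (suc m)) x {k′} → refine k x ≡ suc (suc k′) → k ≡ suc k′
refine-suc zero    true ()
refine-suc (suc k) _    refl = refl

initial : ∀ s n → Stage s n 0
initial s n = record
  { colouring      = record { colour = λ _ _ → zero ; symmetric = λ _ _ → refl }
  ; noClique       = λ _ ()
  ; survivors      = combinations n s
  ; survivors-size = combinations-size n s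
  ; survivors-all  = λ S size _ → ∈-combinations S size
  ; survivors-few  = *-monoˡ-≤ 1 (length-combinations n s)
  }

-- By `clique-bound` with nothing accumulated, such a clique would give 2 ^ (t + 2) ≤ 2 ^ (t + 1).
form-clique-free : ∀ t {n} (f : Vec (Point t) n) (S : Subset n) → ∣ S ∣ ≡ 3 + t →
  ¬ (∀ i j → i Subset.∈ S → j Subset.∈ S → i ≢ j → onPairs form f i j ≡ true)
form-clique-free t f S size mono
  with select S f | trans (length-select S f) size | select-AllPairs form true S f mono
... | x ∷ xs | len | pairs = <⇒≱ (^-monoʳ-< 2 ≤-refl (n<1+n (suc t))) (begin
  2 ^ (2 + t)         ≡⟨ cong (λ l → 2 ^ pred l) len ⟨
  2 ^ length xs       ≤⟨ clique-bound [] x xs (All.universal (λ _ → []) _) pairs ⟩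
  perpSize {suc t} [] ≡⟨ perpSize-[] (suc t) ⟩
  2 ^ suc t           ∎)
  where open ≤-Reasoning

-- The induction step for `survivors-few`, with x and y the numbers of survivors after and before a
-- refinement.
compound : ∀ x y w v N a b → x * w ≤ v * y → y * a ≤ N * b → x * (w * a) ≤ N * (v * b)
compound x y w v N a b xw≤vy ya≤Nb = begin
  x * (w * a)  ≡⟨ *-assoc x w a ⟨
  x * w * a    ≤⟨ *-monoˡ-≤ a xw≤vy ⟩
  v * y * a    ≡⟨ *-assoc v y a ⟩
  v * (y * a)  ≤⟨ *-monoʳ-≤ v ya≤Nb ⟩
  v * (N * b)  ≡⟨ shuffle v N b ⟩
  N * (v * b)  ∎
  where
  open ≤-Reasoning
  shuffle : ∀ x y z → x * (y * z) ≡ y * (x * z)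
  shuffle = solve-∀

module _ {s n m : ℕ} (t : ℕ) (s≡3+t : s ≡ 3 + t) (stage : Stage s n m) where

  open Stage stage

  private
    chosen : ∃[ f ] length (filterᵇ (λ S → independent {t} [] (select S f)) survivors) * 2 ^ triangle s
                  ≤ 16 ^ s * length survivors
    chosen = ∃-few-independent t s≡3+t survivors-size

    f : Vec (Point t) n
    f = proj₁ chosen

    p : Subset n → Bool
    p S = independent [] (select S f)

    refined : EdgeColouring n (2 + m)
    refined = record
      { colour    = λ i j → refine (colour colouring i j) (onPairs form f i j)
      ; symmetric = λ i j → cong₂ refine (symmetric colouring i j) (onPairs-sym form f i j)
      }

    refined-noClique : ∀ S k → ∣ S ∣ ≡ s → ¬ IsMonochromatic (colour refined) (suc k) S
    refined-noClique S zero    size mono = form-clique-free t f S (trans size s≡3+t)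
      λ i j i∈ j∈ i≢j → refine-one (colour colouring i j) _ (mono i j i∈ j∈ i≢j)
    refined-noClique S (suc k) size mono = noClique S k size
      λ i j i∈ j∈ i≢j → refine-suc (colour colouring i j) _ (mono i j i∈ j∈ i≢j)

    refined-survivors : ∀ S → ∣ S ∣ ≡ s → IsMonochromatic (colour refined) zero S → S ∈ filterᵇ p survivors
    refined-survivors S size mono = ∈-filter⁺ (λ S → T? (p S))
      (survivors-all S size λ i j i∈ j∈ i≢j → proj₁ (split i j i∈ j∈ i≢j))
      (Equivalence.from T-≡ (AllPairs⇒independent [] (select S f) (All.universal (λ _ → refl) _)
        (select-AllPairs form false S f λ i j i∈ j∈ i≢j → proj₂ (split i j i∈ j∈ i≢j))))
      where
      split : ∀ i j → i Subset.∈ S → j Subset.∈ S → i ≢ j →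
              colour colouring i j ≡ zero × onPairs form f i j ≡ false
      split i j i∈ j∈ i≢j = refine-zero (colour colouring i j) _ (mono i j i∈ j∈ i≢j)

  extend : Stage s n (suc m)
  extend = record
    { colouring      = refined
    ; noClique       = refined-noClique
    ; survivors      = filterᵇ p survivors
    ; survivors-size = All.filter⁺ (λ S → T? (p S)) survivors-size
    ; survivors-all  = refined-survivors
    ; survivors-few  = compound (length (filterᵇ p survivors)) (length survivors) (2 ^ triangle s) (16 ^ s) (n ^ s)
        ((2 ^ triangle s) ^ m) ((16 ^ s) ^ m) (proj₂ chosen) survivors-few
    }

stages : ∀ {s} t → s ≡ 3 + t → ∀ n m → Stage s n m
stages {s} t s≡3+t n zero    = initial s n
stages     t s≡3+t n (suc m) = extend t s≡3+t (stages t s≡3+t n m)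

¬Arrows : ∀ {s} t → s ≡ 3 + t → ∀ n m →
  n ^ s * (16 ^ s) ^ m < (2 ^ triangle s) ^ m → ¬ Arrows s (suc m) n
¬Arrows t s≡3+t n m small arrows with stages t s≡3+t n m
... | stage with arrows (Stage.colouring stage)
...   | S , size , suc k , mono = Stage.noClique stage S k size mono
...   | S , size , zero  , mono
    with Stage.survivors stage | Stage.survivors-all stage S size mono | Stage.survivors-few stage
-- A clique in colour `zero` would be a survivor, but `small` leaves room for fewer than one.
...     | _ ∷ _ | _ | few = <⇒≱ small (≤-trans (m≤m+n _ _) few)

-- From the counting condition to the asymptotic bound.

r-bound : ∀ {s} t → s ≡ 3 + t → ∀ m → (2 ^ triangle s) ^ m ≤ r s (suc m) ^ s * (16 ^ s) ^ m
r-bound {s} t s≡3+t m =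
  ≮⇒≥ λ small → ¬Arrows t s≡3+t (r s (suc m)) m small (proj₁ (r-isRamseyNumber s (suc m)))

2*triangle : ∀ s → triangle (suc s) + triangle (suc s) ≡ suc s * s
2*triangle zero    = refl
2*triangle (suc s) = trans (shuffle s (triangle (suc s))) (trans (cong (suc s + suc s +_) (2*triangle s)) (shuffle′ s))
  where
  shuffle : ∀ s x → suc s + x + (suc s + x) ≡ suc s + suc s + (x + x)
  shuffle = solve-∀
  shuffle′ : ∀ s → suc s + suc s + suc s * s ≡ suc (suc s) * suc s
  shuffle′ = solve-∀

^-cancelˡ-≤ : ∀ k .{{_ : NonZero k}} {m n} → m ^ k ≤ n ^ k → m ≤ n
^-cancelˡ-≤ k le = ≮⇒≥ λ n<m → <⇒≱ (^-monoˡ-< k n<m) le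

-- Squaring turns the exponent s(s - 1)/2 into s(s - 1). Both sides are then s-th powers, and the
-- root gives 2 ^ (m(s - 1)) ≤ R² 2 ^ (8 m). A further factor 2 ^ m replaces s - 1 by s.
square-bound : ∀ p m R →
  (2 ^ triangle (suc p)) ^ m ≤ R ^ suc p * (16 ^ suc p) ^ m →
  2 ^ (m * suc p) ≤ 2 ^ (5 * m) * 2 ^ (5 * m) * (R * R)
square-bound p m R le = begin
  2 ^ (m * s)                    ≡⟨ cong (2 ^_) (*-suc m p) ⟩
  2 ^ (m + m * p)          ≡⟨ ^-distribˡ-+-* 2 m _ ⟩
  2 ^ m * 2 ^ (m * p)      ≤⟨ *-monoʳ-≤ (2 ^ m) root ⟩
  2 ^ m * (R * R * 2 ^ (8 * m))  ≡⟨ shuffle₁ (2 ^ m) (R * R) (2 ^ (8 * m)) ⟩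
  2 ^ m * 2 ^ (8 * m) * (R * R)  ≡⟨ cong (_* (R * R)) (^-distribˡ-+-* 2 m (8 * m)) ⟨
  -- The exponent 9 m is rounded up to 10 m to make the factor a perfect square D * D, so that the
  -- constant 1 / D is rational.
  2 ^ (m + 8 * m) * (R * R)      ≤⟨ *-monoˡ-≤ (R * R) (^-monoʳ-≤ 2 (≤-trans (m≤n+m _ m) (≤-reflexive (shuffle₂ m)))) ⟩
  2 ^ (5 * m + 5 * m) * (R * R)  ≡⟨ cong (_* (R * R)) (^-distribˡ-+-* 2 (5 * m) (5 * m)) ⟩
  D * D * (R * R)                ∎
  where
  open ≤-Reasoning
  s = suc p
  D = 2 ^ (5 * m)
  w = triangle s
  shuffle₁ : ∀ x y z → x * (y * z) ≡ x * z * y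
  shuffle₁ = solve-∀
  shuffle₂ : ∀ m → m + (m + 8 * m) ≡ 5 * m + 5 * m
  shuffle₂ = solve-∀
  shuffle₃ : ∀ x y → x * y * (x * y) ≡ x * x * (y * y)
  shuffle₃ = solve-∀
  shuffle₄ : ∀ m s → 4 * s * m + 4 * s * m ≡ 8 * m * s
  shuffle₄ = solve-∀
  shuffle₅ : ∀ m s x → m * x * s ≡ s * x * m
  shuffle₅ = solve-∀
  square : ∀ x k → (2 ^ x) ^ k * (2 ^ x) ^ k ≡ 2 ^ ((x + x) * k)
  square x k = trans (cong₂ _*_ (^-*-assoc 2 x k) (^-*-assoc 2 x k))
    (trans (sym (^-distribˡ-+-* 2 (x * k) (x * k))) (cong (2 ^_) (sym (*-distribʳ-+ k x x))))
  16^ : ∀ k → (16 ^ s) ^ k * (16 ^ s) ^ k ≡ (2 ^ (8 * k)) ^ s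
  16^ k = trans (cong (λ x → x ^ k * x ^ k) (^-*-assoc 2 4 s)) (trans (square (4 * s) k)
    (trans (cong (2 ^_) (trans (*-distribʳ-+ k (4 * s) (4 * s)) (shuffle₄ k s))) (sym (^-*-assoc 2 (8 * k) s))))
  root : 2 ^ (m * p) ≤ R * R * 2 ^ (8 * m)
  root = ^-cancelˡ-≤ s {2 ^ (m * p)} {R * R * 2 ^ (8 * m)} (begin
    (2 ^ (m * p)) ^ s                              ≡⟨ ^-*-assoc 2 (m * p) s ⟩
    2 ^ (m * p * s)                                ≡⟨ cong (2 ^_) (shuffle₅ m s p) ⟩
    2 ^ (s * p * m)                                ≡⟨ cong (λ x → 2 ^ (x * m)) (2*triangle p) ⟨
    2 ^ ((w + w) * m)                              ≡⟨ square w m ⟨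
    (2 ^ w) ^ m * (2 ^ w) ^ m                      ≤⟨ *-mono-≤ le le ⟩
    R ^ s * (16 ^ s) ^ m * (R ^ s * (16 ^ s) ^ m)  ≡⟨ shuffle₃ (R ^ s) ((16 ^ s) ^ m) ⟩
    R ^ s * R ^ s * ((16 ^ s) ^ m * (16 ^ s) ^ m)  ≡⟨ cong₂ _*_ (sym (^-distribʳ-* s R R)) (16^ m) ⟩
    (R * R) ^ s * (2 ^ (8 * m)) ^ s                ≡⟨ ^-distribʳ-* s (R * R) (2 ^ (8 * m)) ⟨
    (R * R * 2 ^ (8 * m)) ^ s                      ∎)

scaled-square-≤ : ∀ D .{{_ : NonZero D}} g f → g ≤ D * D * (f * f) →
  ((ℤ.+ 1 / D) ℚᵘ.* (ℤ.+ 1 / D)) ℚᵘ.* fromℕ g ℚᵘ.≤ fromℕ f ℚᵘ.* fromℕ f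
scaled-square-≤ D@(suc d) g f le = *≤* (subst₂ ℤ._≤_ lhs rhs (ℤ.+≤+ le))
  where
  lhs : ℤ.+ g ≡ (ℤ.+ 1 ℤ.* ℤ.+ g) ℤ.* ℤ.+ 1
  lhs = sym (trans (ℤ.*-identityʳ _) (ℤ.*-identityˡ (ℤ.+ g)))
  shuffle : ∀ x y → x * (y * y) ≡ y * y * (x * 1)
  shuffle = solve-∀
  rhs : ℤ.+ (D * D * (f * f)) ≡ (ℤ.+ f ℤ.* ℤ.+ f) ℤ.* ℤ.+ (D * D * 1)
  rhs = trans (cong ℤ.+_ (shuffle (D * D) f))
    (trans (ℤ.pos-* (f * f) (D * D * 1)) (cong (ℤ._* ℤ.+ (D * D * 1)) (ℤ.pos-* f f)))

0<1/ : ∀ D .{{_ : NonZero D}} → ℚᵘ.0ℚᵘ ℚᵘ.< ℤ.+ 1 / D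
0<1/ (suc d) = *<* (ℤ.+<+ z<s)

theorem1p6 : (ℓ : ℕ) → 3 ≤ ℓ → (λ s → r s ℓ) =Ω√ (λ s → 2 ^ ((ℓ ∸ 1) * s))
-- With ℓ = m + 1 there are m graphs and one remaining colour. The constant 2 ^ (-5 m) depends on ℓ
-- only, and the threshold 3 lets s be written as 3 + t.
theorem1p6 (suc m) _ = c , 0<1/ (2 ^ (5 * m)) , 3 , bound
  where
  instance
    D≢0 : NonZero (2 ^ (5 * m))
    D≢0 = m^n≢0 2 (5 * m)
  c = ℤ.+ 1 / (2 ^ (5 * m))
  bound : ∀ s → 3 ≤ s → (c ℚᵘ.* c) ℚᵘ.* fromℕ (2 ^ (m * s)) ℚᵘ.≤ fromℕ (r s (suc m)) ℚᵘ.* fromℕ (r s (suc m))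
  bound (suc (suc (suc t))) _ = scaled-square-≤ (2 ^ (5 * m)) (2 ^ (m * (3 + t))) (r (3 + t) (suc m))
    (square-bound (2 + t) m (r (3 + t) (suc m)) (r-bound t refl m))
  bound (suc zero) (s≤s ())
  bound (suc (suc zero)) (s≤s (s≤s ()))
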